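{- For every co-bipartite graph $G$, the following are equivalent: (1) $G$ is $1$-perfectly orientable; (2) $G$ has an orientation in which every induced $4$-cycle is oriented cyclically; (3) $G$ is a circular arc graph.
   Context: All graphs are finite and simple. A graph is co-bipartite if its complement is bipartite. An orientation of a graph $G$ is $1$-perfect if for every vertex $v$, its out-neighborhood is a clique in $G$; $G$ is $1$-perfectly orientable if it admits a $1$-perfect orientation. A cycle of $G$ is oriented cyclically in an orientation if each of its vertices has exactly one out-neighbor on the cycle. A circular arc graph is the intersection graph of a finite family of closed arcs on a circle.
   Formalization: The circle is taken as the rational points of [0,1), and closed arcs have rational endpoints; a finite family of real arcs has the same intersection graph as one with rational endpoints in the same cyclic order. -}

module Defs where

open import Data.Nat using (ℕ)
open import Data.Bool using (Bool; true; false)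
open import Data.Fin using (Fin)
open import Data.List using (List; []; _∷_; length; filter)
open import Data.Product using (Σ; ∃; _×_; _,_)
open import Data.Sum using (_⊎_)
open import Data.Empty using (⊥)
open import Relation.Nullary using (¬_)
open import Relation.Binary.PropositionalEquality using (_≡_; _≢_)
open import Data.Bool.Properties using (T?)
open import Data.Rational using (ℚ; 0ℚ; 1ℚ; _≤_; _<_)
open import Function.Bundles using (_⇔_)

record Graph (n : ℕ) : Set where
  field
    adj   : Fin n → Fin n → Bool
    sym   : ∀ u v → adj u v ≡ adj v u
    irrefl : ∀ v → adj v v ≡ false
open Graph public

CoEdge : ∀ {n} → Graph n → Fin n → Fin n → Set
CoEdge G u v = (u ≢ v) × (adj G u v ≡ false)

CoBipartite : ∀ {n} → Graph n → Set
CoBipartite {n} G = Σ (Fin n → Bool) λ c → ∀ u v → CoEdge G u v → c u ≢ c v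

record Orientation {n : ℕ} (G : Graph n) : Set where
  field
    out     : Fin n → Fin n → Bool
    onEdge  : ∀ u v → out u v ≡ true → adj G u v ≡ true
    total   : ∀ u v → adj G u v ≡ true → (out u v ≡ true) ⊎ (out v u ≡ true)
    antisym : ∀ u v → out u v ≡ true → out v u ≡ true → ⊥
open Orientation public

OnePerfect : ∀ {n} {G : Graph n} → Orientation G → Set
OnePerfect {n} {G} o =
  ∀ v u w → out o v u ≡ true → out o v w ≡ true → u ≢ w → adj G u w ≡ true

OnePerfectlyOrientable : ∀ {n} → Graph n → Set
OnePerfectlyOrientable G = Σ (Orientation G) OnePerfect

Induced4Cycle : ∀ {n} → Graph n → Fin n → Fin n → Fin n → Fin n → Set
Induced4Cycle G a b c d =
  (a ≢ b) × (a ≢ c) × (a ≢ d) × (b ≢ c) × (b ≢ d) × (c ≢ d) ×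
  (adj G a b ≡ true) × (adj G b c ≡ true) × (adj G c d ≡ true) × (adj G d a ≡ true) ×
  (adj G a c ≡ false) × (adj G b d ≡ false)

outCount : ∀ {n} {G : Graph n} → Orientation G → Fin n → List (Fin n) → ℕ
outCount o v xs = length (filter (λ x → T? (out o v x)) xs)

CyclicallyOriented : ∀ {n} {G : Graph n} → Orientation G → Fin n → Fin n → Fin n → Fin n → Set
CyclicallyOriented o a b c d =
  let cyc = a ∷ b ∷ c ∷ d ∷ [] in
  (outCount o a cyc ≡ 1) × (outCount o b cyc ≡ 1) ×
  (outCount o c cyc ≡ 1) × (outCount o d cyc ≡ 1)

C4CyclicallyOrientable : ∀ {n} → Graph n → Set
C4CyclicallyOrientable G =
  Σ (Orientation G) λ o → ∀ a b c d → Induced4Cycle G a b c d → CyclicallyOriented o a b c d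

-- The circle is modelled as [0,1) ⊆ ℚ (wrapping around at 1).
OnCircle : ℚ → Set
OnCircle x = (0ℚ ≤ x) × (x < 1ℚ)

-- Closed arcs: the whole circle, or the closed arc running counter-clockwise
-- (increasing direction) from s to e (a single point if s = e, wrapping past 0 if e < s).
data Arc : Set where
  whole : Arc
  seg   : (s e : ℚ) → OnCircle s → OnCircle e → Arc

_∈Arc_ : ℚ → Arc → Set
x ∈Arc whole = OnCircle x
x ∈Arc seg s e _ _ =
  OnCircle x × (((s ≤ e) × (s ≤ x) × (x ≤ e)) ⊎ ((e < s) × ((s ≤ x) ⊎ (x ≤ e))))

CircularArc : ∀ {n} → Graph n → Set
CircularArc {n} G =
  Σ (Fin n → Arc) λ A → ∀ u v → u ≢ v →
    (adj G u v ≡ true) ⇔ (∃ λ x → (x ∈Arc A u) × (x ∈Arc A v))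

{-# OPTIONS --safe #-}
module Submission where

-- A clique cover by two sides A, B turns an orientation into a 2-colouring of the
-- edges between A and B: by direction. An induced 4-cycle consists of two
-- conflicting such edges (their endpoints in A and B not being cross-adjacent), and
-- both orientation properties amount to conflicting edges having different colours.
-- By Cogis' theorem such a colouring yields a cover of the crossing edges by two
-- chain graphs; these describe on which of its two ends an arc of A, around one
-- pole of the circle, overlaps an arc of B, around the other pole. Conversely, in
-- any arc model orient u towards v if the arc of v contains the end of the arc of
-- u: the arcs of all out-neighbours of u then share that end.

open import Defs renaming (sym to adj-sym)
open import Data.Bool using (Bool; true; false; not; if_then_else_)
open import Data.Bool.Properties using (¬-not; not-¬; not-injective; not-involutive)
  renaming (_≟_ to _≟ᵇ_)
open import Data.Empty using (⊥; ⊥-elim)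
open import Data.Fin as Fin using (Fin; zero; suc)
open import Data.Fin.Induction using (<-wellFounded)
open import Data.Fin.Properties as Fin using (all?; any?)
open import Data.Fin.Subset using (Subset; _∈_; ∣_∣)
open import Data.Fin.Subset.Properties using (p⊆q⇒∣p∣≤∣q∣; p⊂q⇒∣p∣<∣q∣; ∣p∣≤n)
import Data.Integer as ℤ
import Data.Integer.Properties as ℤ
open import Data.List using (_∷_; [])
open import Data.Nat as ℕ using (ℕ; zero; suc; _+_; _∸_)
import Data.Nat.Properties as ℕ
import Data.Nat.Induction as ℕ
open import Data.Nat.Coprimality using (Coprime; 1-coprimeTo; coprime-+) renaming (sym to coprime-sym)
open import Data.Product using (∃; _×_; _,_; proj₁; proj₂; map₂) renaming (swap to ×-swap)
open import Data.Rational as ℚ using (ℚ; mkℚ; 0ℚ; 1ℚ; *≤*; *<*)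
import Data.Rational.Properties as ℚ
open import Data.Sum using (_⊎_; inj₁; inj₂; swap; [_,_]′) renaming (map to map⊎)
open import Data.Vec using (tabulate)
open import Data.Vec.Properties using (lookup∘tabulate; lookup⇒[]=; []=⇒lookup)
open import Function using (_∘_; id; case_of_)
open import Function.Bundles using (_⇔_; mk⇔; Equivalence)
open import Induction.WellFounded using (Acc; acc; WellFounded)
open import Relation.Binary.Definitions using (tri<; tri≈; tri>)
open import Relation.Binary.PropositionalEquality
  using (_≡_; _≢_; refl; sym; trans; cong; subst; subst₂)
open import Relation.Nullary using (¬_; Dec; yes; no; does; contradiction)
open import Relation.Nullary.Decidable
  using (_×-dec_; _⊎-dec_; _→-dec_; ¬?; decidable-stable; dec-true)

-- Cardinalities and least elements of decidable subsets of `Fin n`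

does⁻ : ∀ {P : Set} (P? : Dec P) → does P? ≡ true → P
does⁻ (yes p) _ = p

ind : Bool → ℕ
ind b = if b then 1 else 0

module _ {n} {P : Fin n → Set} (P? : ∀ i → Dec (P i)) where

  decSubset : Subset n
  decSubset = tabulate (does ∘ P?)

  card : ℕ
  card = ∣ decSubset ∣

  card≤n : card ℕ.≤ n
  card≤n = ∣p∣≤n decSubset

  ∈-decSubset⁺ : ∀ {i} → P i → i ∈ decSubset
  ∈-decSubset⁺ {i} p = lookup⇒[]= i _ (trans (lookup∘tabulate _ i) (dec-true (P? i) p))

  ∈-decSubset⁻ : ∀ {i} → i ∈ decSubset → P i
  ∈-decSubset⁻ {i} i∈ = does⁻ (P? i) (trans (sym (lookup∘tabulate _ i)) ([]=⇒lookup i∈))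

  least : ∃ P → ∃ λ i → P i × (∀ j → j Fin.< i → ¬ P j)
  least (i , p) = go (<-wellFounded i) p
    where
    go : ∀ {i} → Acc Fin._<_ i → P i → ∃ λ i → P i × (∀ j → j Fin.< i → ¬ P j)
    go {i} (acc rs) p with any? (λ j → (j Fin.<? i) ×-dec P? j)
    ... | yes (j , j<i , q) = go (rs j<i) q
    ... | no ¬q             = i , p , λ j j<i q → ¬q (j , j<i , q)

module _ {n} {P Q : Fin n → Set} (P? : ∀ i → Dec (P i)) (Q? : ∀ i → Dec (Q i)) where

  card-mono : (∀ i → P i → Q i) → card P? ℕ.≤ card Q?
  card-mono P⊆Q = p⊆q⇒∣p∣≤∣q∣ (∈-decSubset⁺ Q? ∘ P⊆Q _ ∘ ∈-decSubset⁻ P?)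

  card-strict : (∀ i → P i → Q i) → (∃ λ i → Q i × ¬ P i) → card P? ℕ.< card Q?
  card-strict P⊆Q (i , q , ¬p) = p⊂q⇒∣p∣<∣q∣
    ( (λ {j} → ∈-decSubset⁺ Q? ∘ P⊆Q j ∘ ∈-decSubset⁻ P?)
    , i , ∈-decSubset⁺ Q? q , ¬p ∘ ∈-decSubset⁻ P?)

-- The lexicographic order on vectors of fixed length

_≺_ : ∀ {n} → (Fin n → ℕ) → (Fin n → ℕ) → Set
f ≺ g = ∃ λ k → (∀ j → j Fin.< k → f j ≡ g j) × f k ℕ.< g k

-- Nested induction: outside on the value at `zero`, inside on the tail. When the value at `zero`
-- drops, the new tail is arbitrary, and its accessibility comes from the smaller length.
≺-wellFounded : ∀ {n} → WellFounded (_≺_ {n})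
≺-wellFounded {zero}  f = acc λ { (() , _) }
≺-wellFounded {suc n} f = go (ℕ.<-wellFounded _) (≺-wellFounded _) refl
  where
  go : ∀ {k} {f : Fin (suc n) → ℕ} → Acc ℕ._<_ k → Acc _≺_ (f ∘ suc) → f zero ≡ k → Acc _≺_ f
  below : ∀ {k} {f : Fin (suc n) → ℕ} → Acc ℕ._<_ k → Acc _≺_ (f ∘ suc) → f zero ≡ k →
          ∀ {g} → g ≺ f → Acc _≺_ g

  go a b f0≡k = acc (below a b f0≡k)

  below (acc rs) _ f0≡k (zero , _ , lt) = go (rs (subst (_ ℕ.<_) f0≡k lt)) (≺-wellFounded _) refl
  below a (acc ss) f0≡k (suc k , eq , lt) = go a
    (ss (k , (λ j j<k → eq (suc j) (ℕ.s≤s j<k)) , lt))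
    (trans (eq zero (ℕ.s≤s ℕ.z≤n)) f0≡k)

-- Chain graphs (Ferrers relations) as threshold relations

Chain : ∀ {m n} → (Fin m → Fin n → Set) → Set
Chain F = ∀ {x y x′ y′} → F x y → F x′ y′ → F x y′ ⊎ F x′ y

module _ {m n} {F : Fin m → Fin n → Set} (F? : ∀ x y → Dec (F x y)) where

  below? : ∀ x x′ → Dec (∀ y → F x′ y → F x y)
  below? x x′ = all? λ y → F? x′ y →-dec F? x y

  outside? : ∀ y x → Dec (¬ F x y)
  outside? y x = ¬? (F? x y)

  rank : Fin m → ℕ
  rank x = card (below? x)

  threshold : Fin n → ℕ
  threshold y = card (outside? y)

  -- By the chain property, every row that misses `y` has its neighbourhood inside that of `x`, so
  -- it is counted by the rank. The row `x` itself is counted by the rank only, which makes the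
  -- inequality strict.
  threshold<rank : Chain F → ∀ {x y} → F x y → threshold y ℕ.< rank x
  threshold<rank chain {x} {y} xy = card-strict (outside? y) (below? x)
    (λ x′ ¬x′y y′ x′y′ → [ ⊥-elim ∘ ¬x′y , id ]′ (chain x′y′ xy))
    (x , (λ _ → id) , λ ¬xy → ¬xy xy)

  -- If `x` missed `y`, so would every row whose neighbourhood lies inside that of `x`, and the rank
  -- could not exceed the threshold.
  threshold<rank⁻¹ : ∀ {x y} → threshold y ℕ.< rank x → F x y
  threshold<rank⁻¹ {x} {y} lt = decidable-stable (F? x y) λ ¬xy →
    ℕ.<⇒≱ lt (card-mono (below? x) (outside? y) λ x′ x′⊆x → ¬xy ∘ x′⊆x y)

-- Proper colourings of conflicting edges and removal of hexagons

module _ {m n} {R : Fin m → Fin n → Set} (R? : ∀ x y → Dec (R x y)) where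

  Conflict : Fin m → Fin n → Fin m → Fin n → Set
  Conflict x y x′ y′ = R x y × R x′ y′ × ¬ R x y′ × ¬ R x′ y

  conflict-sym : ∀ {x y x′ y′} → Conflict x y x′ y′ → Conflict x′ y′ x y
  conflict-sym (xy , x′y′ , ¬xy′ , ¬x′y) = x′y′ , xy , ¬x′y , ¬xy′

  Conflicted : Fin m → Fin n → Set
  Conflicted x y = ∃ λ x′ → ∃ λ y′ → Conflict x y x′ y′

  conflicted? : ∀ x y → Dec (Conflicted x y)
  conflicted? x y = any? λ x′ → any? λ y′ →
    R? x y ×-dec R? x′ y′ ×-dec ¬? (R? x y′) ×-dec ¬? (R? x′ y)

  ProperColouring : (Fin m → Fin n → Bool) → Set
  ProperColouring c = ∀ {x y x′ y′} → Conflict x y x′ y′ → c x y ≡ not (c x′ y′)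

  -- If (x , y) conflicts with (x′ , y′), then x b x′ y′ a y is a 6-cycle of R
  -- whose edges are coloured alternately.
  Hexagon : (Fin m → Fin n → Bool) → Fin m → Fin n → Fin m → Fin n → Set
  Hexagon c x y a b =
    R x b × R a y × ¬ R a b × c x b ≡ not (c x y) × c a y ≡ not (c x y) × Conflicted x y

  opaque
    hexagon? : ∀ c x y a b → Dec (Hexagon c x y a b)
    hexagon? c x y a b =
      R? x b ×-dec R? a y ×-dec ¬? (R? a b) ×-dec
      (c x b ≟ᵇ not (c x y)) ×-dec (c a y ≟ᵇ not (c x y)) ×-dec conflicted? x y

  HexagonFree : (Fin m → Fin n → Bool) → Set
  HexagonFree c = ∀ {x y a b} → ¬ Hexagon c x y a b

  module _ {c : Fin m → Fin n → Bool} (proper : ProperColouring c) where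

    same-colour⇒R : ∀ {x y x′ y′} → R x y → R x′ y′ → c x y ≡ c x′ y′ → ¬ R x y′ → R x′ y
    same-colour⇒R xy x′y′ eq ¬xy′ = decidable-stable (R? _ _) λ ¬x′y →
      not-¬ eq (proper (xy , x′y′ , ¬xy′ , ¬x′y))

    -- The partner `(x′ , y′)` has the same colour as `(x , b)` and `(a , y)`, so it conflicts with
    -- neither; this yields the two missing sides of the 6-cycle.
    hexagon-sides : ∀ {x y a b x′ y′} → Hexagon c x y a b → Conflict x y x′ y′ → R x′ b × R a y′
    hexagon-sides (xb , ay , _ , cxb , cay , _) k@(xy , x′y′ , ¬xy′ , ¬x′y) =
      same-colour⇒R xb x′y′ (trans cxb (sym c′)) ¬xy′ ,
      same-colour⇒R x′y′ ay (trans c′ (sym cay)) ¬x′y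
      where
      c′ : c _ _ ≡ not (c _ _)
      c′ = proper (conflict-sym k)

    -- So for fixed a , b the edges with a hexagon can change colour together.
    hexagon-closed : ∀ {x y a b x′ y′} → Hexagon c x y a b → Conflict x y x′ y′ → Hexagon c x′ y′ a b
    hexagon-closed h@(xb , ay , ¬ab , cxb , cay , _) k@(xy , x′y′ , ¬xy′ , ¬x′y)
      with hexagon-sides h k
    ... | x′b , ay′ = x′b , ay′ , ¬ab ,
      trans (proper (x′b , ay , ¬x′y , ¬ab)) (trans (cong not cay) (cong not (sym c′))) ,
      trans (proper (ay′ , xb , ¬ab , ¬xy′)) (trans (cong not cxb) (cong not (sym c′))) ,
      (_ , _ , conflict-sym k)
      where
      c′ : c _ _ ≡ not (c _ _)
      c′ = proper (conflict-sym k)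

    -- The two edges of the hexagon at x have different colours, so some edge of row x
    -- with a hexagon is coloured true.
    hexagon-rotate : ∀ {x y a b} → R x y → Hexagon c x y a b → ∃ λ a′ → Hexagon c x b a′ y
    hexagon-rotate {x} {y} {a} {b} xy h@(xb , ay , ¬ab , cxb , cay , x′ , y′ , k@(_ , _ , ¬xy′ , ¬x′y))
      with hexagon-sides h k | hexagon-closed h k
    ... | x′b , ay′ | _ , _ , _ , cx′b , _ =
      x′ , xy , x′b , ¬x′y , sym (trans (cong not cxb) (not-involutive _)) ,
      trans cx′b (cong not (trans (proper (conflict-sym k)) (sym cxb))) ,
      (a , y′ , xb , ay′ , ¬xy′ , ¬ab)

  flip : (Fin m → Fin n → Bool) → Fin m → Fin n → Fin m → Fin n → Bool
  flip c a b x y = if does (hexagon? c x y a b) then not (c x y) else c x y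

  flip-proper : ∀ {c} → ProperColouring c → ∀ a b → ProperColouring (flip c a b)
  flip-proper {c} proper a b {x} {y} {x′} {y′} k
    with hexagon? c x y a b | hexagon? c x′ y′ a b
  ... | yes _ | yes _  = cong not (proper k)
  ... | yes h | no ¬h′ = contradiction (hexagon-closed proper h k) ¬h′
  ... | no ¬h | yes h′ = contradiction (hexagon-closed proper h′ (conflict-sym k)) ¬h
  ... | no _  | no _   = proper k

  true? : ∀ (c : Fin m → Fin n → Bool) x y → Dec (c x y ≡ true)
  true? c x y = c x y ≟ᵇ true

  -- Counted row by row for the lexicographic comparison: a flip at the first row with a hexagon
  -- leaves earlier rows alone but may change later rows in either direction.
  weight : (Fin m → Fin n → Bool) → Fin m → ℕ
  weight c x = card (true? c x)

  -- All edges of row x with a hexagon on a , b have the colour opposite to (x , b),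
  -- so flipping changes colours in row x only from true to false.
  flip-decreases : ∀ {c x y a b} → (∀ j → j Fin.< x → ∀ y′ → ¬ Hexagon c j y′ a b) →
    Hexagon c x y a b → c x y ≡ true → weight (flip c a b) ≺ weight c
  flip-decreases {c} {x} {y} {a} {b} first h@(_ , _ , _ , cxb , _) cxy =
    x , above , card-strict (true? (flip c a b) x) (true? c x) row (y , cxy , flipped)
    where
    above : ∀ j → j Fin.< x → weight (flip c a b) j ≡ weight c j
    above j j<x = ℕ.≤-antisym
      (card-mono (true? (flip c a b) j) (true? c j) λ y′ → subst (_≡ true) (unchanged y′))
      (card-mono (true? c j) (true? (flip c a b) j) λ y′ → subst (_≡ true) (sym (unchanged y′)))
      where
      unchanged : ∀ y′ → flip c a b j y′ ≡ c j y′
      unchanged y′ with hexagon? c j y′ a b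
      ... | yes h = contradiction h (first j j<x y′)
      ... | no _  = refl

    row : ∀ y′ → flip c a b x y′ ≡ true → c x y′ ≡ true
    row y′ eq with hexagon? c x y′ a b
    ... | yes (_ , _ , _ , cxb′ , _) = trans (not-injective (trans (sym cxb′) cxb)) cxy
    ... | no _ = eq

    flipped : flip c a b x y ≢ true
    flipped eq rewrite dec-true (hexagon? c x y a b) h | cxy = case eq of λ ()

  -- Descent on `weight`: as long as some hexagon exists, flip one in the least row that has any.
  hexagonFree-colouring : ∀ {c} → ProperColouring c → ∃ λ c′ → ProperColouring c′ × HexagonFree c′
  hexagonFree-colouring proper = go proper (≺-wellFounded _)
    where
    go : ∀ {c} → ProperColouring c → Acc _≺_ (weight c) → ∃ λ c′ → ProperColouring c′ × HexagonFree c′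
    go {c} proper (acc rs)
      with any? (λ x → any? λ y → any? λ a → any? λ b → hexagon? c x y a b)
    ... | no ¬h = c , proper , λ h → ¬h (_ , _ , _ , _ , h)
    ... | yes h∃ with least (λ x → any? λ y → any? λ a → any? λ b → hexagon? c x y a b) h∃
    ... | x , (y , a , b , h@(_ , _ , _ , cxb , _ , _ , _ , (xy , _))) , first with c x y ≟ᵇ true
    ... | yes cxy = go (flip-proper proper a b)
            (rs (flip-decreases (λ j j<x y′ h′ → first j j<x (y′ , a , b , h′)) h cxy))
    -- The rotated hexagon belongs to `(x , b)`, an edge of the same least row that is coloured
    -- true, so flipping it does decrease the weight.
    ... | no ¬cxy with hexagon-rotate proper xy h
    ... | a′ , h′ = go (flip-proper proper a′ y)
            (rs (flip-decreases (λ j j<x y′ h″ → first j j<x (y′ , a′ , y , h″)) h′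
              (trans cxb (cong not (¬-not ¬cxy)))))

  -- Colour classes of a hexagon-free colouring as chain graphs

  Part : (Fin m → Fin n → Bool) → Bool → Fin m → Fin n → Set
  Part c t x y = R x y × (c x y ≡ t ⊎ ¬ Conflicted x y)

  part? : ∀ c t x y → Dec (Part c t x y)
  part? c t x y = R? x y ×-dec ((c x y ≟ᵇ t) ⊎-dec ¬? (conflicted? x y))

  module _ {c : Fin m → Fin n → Bool} (proper : ProperColouring c) (t : Bool) where

    part-colour : ∀ {x y x′ y′} → Part c t x y → Conflict x y x′ y′ → c x y ≡ t
    part-colour (_ , inj₁ eq) _ = eq
    part-colour (_ , inj₂ ¬k) k = contradiction (_ , _ , k) ¬k

    part-conflict : ∀ {x y x′ y′} → Part c t x y → Part c t x′ y′ → ¬ Conflict x y x′ y′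
    part-conflict p q k =
      not-¬ (trans (part-colour p k) (sym (part-colour q (conflict-sym k)))) (proper k)

    part⇒R : ∀ {x y x′ y′} → Part c t x y → Part c t x′ y′ → ¬ R x y′ → R x′ y
    part⇒R p q ¬xy′ = decidable-stable (R? _ _) λ ¬x′y →
      part-conflict p q (proj₁ p , proj₁ q , ¬xy′ , ¬x′y)

    conflict⇒∉part : ∀ {x y x′ y′} → Part c t x y → Conflict x y x′ y′ → ¬ Part c t x′ y′
    conflict⇒∉part p k q = part-conflict p q k

    -- Edges without conflicts belong to both parts, so an edge outside the part has a conflict and
    -- the colour `not t`; its partner then has colour `t`.
    partner∈part : ∀ {x y} → R x y → ¬ Part c t x y →
      ∃ λ x′ → ∃ λ y′ → Conflict x y x′ y′ × Part c t x′ y′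
    partner∈part {x} {y} xy ∉ with conflicted? x y
    ... | no ¬k = contradiction (xy , inj₂ ¬k) ∉
    ... | yes (x′ , y′ , k@(_ , x′y′ , _)) = x′ , y′ , k , x′y′ , inj₁
      (trans (trans (proper (conflict-sym k)) (cong not (¬-not λ eq → ∉ (xy , inj₁ eq))))
             (not-involutive t))

    module _ (free : HexagonFree c) where

      -- Otherwise `(x₁ , y₂)` has a partner `(x₃ , y₃)` in the part, and this partner has a hexagon
      -- with `a = x₂` and `b = y₁`.
      part-shortcut : ∀ {x₁ y₁ x₂ y₂} → Part c t x₁ y₁ → Part c t x₂ y₂ → R x₁ y₂ → ¬ R x₂ y₁ →
              Part c t x₁ y₂
      part-shortcut {x₁} {y₁} {x₂} {y₂} p₁ p₂ x₁y₂ ¬x₂y₁ =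
        decidable-stable (part? c t x₁ y₂) λ ∉ → hexagon (partner∈part x₁y₂ ∉)
        where
        hexagon : ¬ (∃ λ x₃ → ∃ λ y₃ → Conflict x₁ y₂ x₃ y₃ × Part c t x₃ y₃)
        hexagon (x₃ , y₃ , k@(_ , x₃y₃ , ¬x₁y₃ , ¬x₃y₂) , p₃) =
          free (x₃y₁ , x₂y₃ , ¬x₂y₁ , opposite k₃ p₂ , opposite k₂ p₁ , (_ , _ , conflict-sym k))
          where
          x₃y₁ : R x₃ y₁
          x₃y₁ = part⇒R p₁ p₃ ¬x₁y₃
          x₂y₃ : R x₂ y₃
          x₂y₃ = part⇒R p₃ p₂ ¬x₃y₂
          k₃ : Conflict x₃ y₁ x₂ y₂
          k₃ = x₃y₁ , proj₁ p₂ , ¬x₃y₂ , ¬x₂y₁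
          k₂ : Conflict x₂ y₃ x₁ y₁
          k₂ = x₂y₃ , proj₁ p₁ , ¬x₂y₁ , ¬x₁y₃
          opposite : ∀ {x y x′ y′} → Conflict x y x′ y′ → Part c t x′ y′ → c x y ≡ not (c x₃ y₃)
          opposite k′ q = trans (proper k′) (cong not
            (trans (part-colour q (conflict-sym k′)) (sym (part-colour p₃ (conflict-sym k)))))

      -- If `R x₃ y₄` held, its conflict with `(x₂ , y₂)` would keep it out of the part; then
      -- `part-shortcut` forces `R x₄ y₃`, which stays out because of `(x₁ , y₁)`. Of the
      -- conflicting edges `(x₁ , y₄)` and `(x₂ , y₃)` the former is not in the part, so the latter
      -- is, and a last shortcut puts `(x₄ , y₃)` into the part after all.
      no-crossed-partners : ∀ {x₁ y₁ x₂ y₂ x₃ y₃ x₄ y₄} →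
        Part c t x₁ y₁ → Part c t x₂ y₂ → Part c t x₃ y₃ → Part c t x₄ y₄ →
        ¬ R x₁ y₃ → ¬ R x₃ y₂ → ¬ R x₂ y₄ → ¬ R x₄ y₁ → ¬ R x₃ y₄
      no-crossed-partners {x₁} {y₁} {x₂} {y₂} {x₃} {y₃} {x₄} {y₄} p₁ p₂ p₃ p₄ ¬x₁y₃ ¬x₃y₂ ¬x₂y₄ ¬x₄y₁ x₃y₄ =
        x₄y₃∉ (part-shortcut p₄ x₂y₃∈ x₄y₃ ¬x₂y₄)
        where
        x₃y₄∉ : ¬ Part c t x₃ y₄
        x₃y₄∉ = conflict⇒∉part p₂ (proj₁ p₂ , x₃y₄ , ¬x₂y₄ , ¬x₃y₂)
        x₄y₃ : R x₄ y₃
        x₄y₃ = decidable-stable (R? x₄ y₃) (x₃y₄∉ ∘ part-shortcut p₃ p₄ x₃y₄)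
        x₄y₃∉ : ¬ Part c t x₄ y₃
        x₄y₃∉ = conflict⇒∉part p₁ (proj₁ p₁ , x₄y₃ , ¬x₁y₃ , ¬x₄y₁)
        x₁y₄ : R x₁ y₄
        x₁y₄ = part⇒R p₄ p₁ ¬x₄y₁
        x₂y₃ : R x₂ y₃
        x₂y₃ = part⇒R p₃ p₂ ¬x₃y₂
        x₁y₄∉ : ¬ Part c t x₁ y₄
        x₁y₄∉ q = x₃y₄∉ (part-shortcut p₃ q x₃y₄ ¬x₁y₃)
        x₂y₃∈ : Part c t x₂ y₃
        x₂y₃∈ = decidable-stable (part? c t x₂ y₃) λ ∉ →
          x₁y₄∉ (x₁y₄ , inj₁ (trans (proper (x₁y₄ , x₂y₃ , ¬x₁y₃ , ¬x₂y₄))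
            (trans (cong not (¬-not λ eq → ∉ (x₂y₃ , inj₁ eq))) (not-involutive t))))

      part-chain : Chain (Part c t)
      part-chain {x₁} {y₁} {x₂} {y₂} p₁ p₂ = decidable-stable (part? c t x₁ y₂ ⊎-dec part? c t x₂ y₁) λ ∉ →
        impossible (∉ ∘ inj₁) (∉ ∘ inj₂)
        where
        impossible : ¬ Part c t x₁ y₂ → ¬ Part c t x₂ y₁ → ⊥
        impossible ∉₁₂ ∉₂₁ with R? x₁ y₂ | R? x₂ y₁
        ... | no ¬x₁y₂ | no ¬x₂y₁ = part-conflict p₁ p₂ (proj₁ p₁ , proj₁ p₂ , ¬x₁y₂ , ¬x₂y₁)
        ... | yes x₁y₂ | no ¬x₂y₁ = ∉₁₂ (part-shortcut p₁ p₂ x₁y₂ ¬x₂y₁)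
        ... | no ¬x₁y₂ | yes x₂y₁ = ∉₂₁ (part-shortcut p₂ p₁ x₂y₁ ¬x₁y₂)
        -- Both diagonals have partners in the part, and these two partners would conflict with each
        -- other.
        ... | yes x₁y₂ | yes x₂y₁ with partner∈part x₁y₂ ∉₁₂ | partner∈part x₂y₁ ∉₂₁
        ... | x₃ , y₃ , (_ , _ , ¬x₁y₃ , ¬x₃y₂) , p₃ | x₄ , y₄ , (_ , _ , ¬x₂y₄ , ¬x₄y₁) , p₄ =
          part-conflict p₃ p₄ (proj₁ p₃ , proj₁ p₄ ,
            no-crossed-partners p₁ p₂ p₃ p₄ ¬x₁y₃ ¬x₃y₂ ¬x₂y₄ ¬x₄y₁ ,
            no-crossed-partners p₂ p₁ p₄ p₃ ¬x₂y₄ ¬x₄y₁ ¬x₁y₃ ¬x₃y₂)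

  part-cover : ∀ c {x y} → R x y → Part c true x y ⊎ Part c false x y
  part-cover c {x} {y} xy with c x y ≟ᵇ true
  ... | yes eq = inj₁ (xy , inj₁ eq)
  ... | no neq = inj₂ (xy , inj₁ (¬-not neq))

  -- Due to Cogis (in terms of the Ferrers dimension of R).
  two-chain-cover : ∀ {c} → ProperColouring c →
    ∃ λ (F : Bool → Fin m → Fin n → Set) →
      (∀ t x y → Dec (F t x y)) × (∀ t → Chain (F t)) ×
      (∀ {x y} → R x y ⇔ (F true x y ⊎ F false x y))
  two-chain-cover proper with hexagonFree-colouring proper
  ... | c , proper′ , free = Part c , part? c , (λ t → part-chain proper′ t free) ,
    mk⇔ (part-cover c) [ proj₁ , proj₁ ]′

-- Orientations, induced 4-cycles and forced edges

module _ {n} {G : Graph n} where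

  adj⇒≢ : ∀ {u v} → adj G u v ≡ true → u ≢ v
  adj⇒≢ {u} uv refl = not-¬ uv (irrefl G u)

  adj-symʳ : ∀ {u v b} → adj G u v ≡ b → adj G v u ≡ b
  adj-symʳ = trans (adj-sym G _ _)

  total-false : ∀ (o : Orientation G) {u v} → adj G u v ≡ true → out o u v ≡ false → out o v u ≡ true
  total-false o uv ¬uv with total o _ _ uv
  ... | inj₁ u→v = contradiction ¬uv (not-¬ u→v)
  ... | inj₂ v→u = v→u

  nonadj⇒¬out : ∀ (o : Orientation G) {u v} → adj G u v ≡ false → out o u v ≡ false
  nonadj⇒¬out o ¬uv = ¬-not λ u→v → not-¬ (onEdge o _ _ u→v) ¬uv

  rotate : ∀ {a b c d} → Induced4Cycle G a b c d → Induced4Cycle G b c d a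
  rotate (a≢b , a≢c , a≢d , b≢c , b≢d , c≢d , ab , bc , cd , da , ac , bd) =
    b≢c , b≢d , a≢b ∘ sym , c≢d , a≢c ∘ sym , a≢d ∘ sym , bc , cd , da , ab , bd , adj-symʳ ac

  -- A vertex has at most one out-neighbour on the cycle, so b → a forces c → b, d → c
  -- and a → d in turn.
  opposite-sides : ∀ {o : Orientation G} → OnePerfect o → ∀ {a b c d} → Induced4Cycle G a b c d →
    out o a d ≡ not (out o a b)
  opposite-sides {o} perfect {a} {b} {c} {d} (_ , a≢c , _ , _ , b≢d , _ , ab , bc , cd , da , ac , bd)
    with out o a b in eq
  ... | true  = ¬-not λ a→d → not-¬ (perfect a b d eq a→d b≢d) bd
  ... | false = total-false o da (¬-not λ d→a → not-¬ (perfect d a c d→a d→c a≢c) ac)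
    where
    b→a : out o b a ≡ true
    b→a = total-false o ab eq
    c→b : out o c b ≡ true
    c→b = total-false o bc (¬-not λ b→c → not-¬ (perfect b a c b→a b→c a≢c) ac)
    d→c : out o d c ≡ true
    d→c = total-false o cd (¬-not λ c→d → not-¬ (perfect c b d c→b c→d b≢d) bd)

  outCount₄ : ∀ (o : Orientation G) v {a b c d} → outCount o v (a ∷ b ∷ c ∷ d ∷ []) ≡
    ind (out o v a) + (ind (out o v b) + (ind (out o v c) + (ind (out o v d) + 0)))
  outCount₄ o v {a} {b} {c} {d} =
    trans (step a _) (cong (ind _ +_) (trans (step b _) (cong (ind _ +_)
      (trans (step c _) (cong (ind _ +_) (step d []))))))
    where
    step : ∀ x xs → outCount o v (x ∷ xs) ≡ ind (out o v x) + outCount o v xs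
    step x xs with out o v x
    ... | true  = refl
    ... | false = refl

  -- At each vertex, the vertex itself and the opposite one contribute 0 to the count. The two cycle
  -- neighbours together contribute 1, by `opposite-sides` for the suitable rotation.
  onePerfect⇒cyclic : ∀ {o : Orientation G} → OnePerfect o → ∀ {a b c d} → Induced4Cycle G a b c d →
    CyclicallyOriented o a b c d
  onePerfect⇒cyclic {o} perfect {a} {b} {c} {d} k₀@(_ , _ , _ , _ , _ , _ , _ , _ , _ , _ , ac , bd) =
    trans (outCount₄ o a) at-a , trans (outCount₄ o b) at-b ,
    trans (outCount₄ o c) at-c , trans (outCount₄ o d) at-d
    where
    k₁ = rotate k₀
    k₂ = rotate k₁
    k₃ = rotate k₂
    loop : ∀ v → out o v v ≡ false
    loop v = nonadj⇒¬out o (irrefl G v)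
    at-a : ind (out o a a) + (ind (out o a b) + (ind (out o a c) + (ind (out o a d) + 0))) ≡ 1
    at-a rewrite loop a | nonadj⇒¬out o ac | opposite-sides {o} perfect k₀ with out o a b
    ... | true  = refl
    ... | false = refl
    at-b : ind (out o b a) + (ind (out o b b) + (ind (out o b c) + (ind (out o b d) + 0))) ≡ 1
    at-b rewrite loop b | nonadj⇒¬out o bd | opposite-sides {o} perfect k₁ with out o b c
    ... | true  = refl
    ... | false = refl
    at-c : ind (out o c a) + (ind (out o c b) + (ind (out o c c) + (ind (out o c d) + 0))) ≡ 1
    at-c rewrite loop c | nonadj⇒¬out o (adj-symʳ ac) | opposite-sides {o} perfect k₂ with out o c d
    ... | true  = refl
    ... | false = refl
    at-d : ind (out o d a) + (ind (out o d b) + (ind (out o d c) + (ind (out o d d) + 0))) ≡ 1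
    at-d rewrite loop d | nonadj⇒¬out o (adj-symʳ bd) | opposite-sides {o} perfect k₃ with out o d a
    ... | true  = refl
    ... | false = refl

  onePerfect⇒C4 : OnePerfectlyOrientable G → C4CyclicallyOrientable G
  onePerfect⇒C4 (o , perfect) = o , λ _ _ _ _ → onePerfect⇒cyclic {o} perfect

  fromRelation : {P : Fin n → Fin n → Set} → (∀ u v → Dec (P u v)) →
    (∀ {u v} → P u v → adj G u v ≡ true) →
    (∀ {u v} → adj G u v ≡ true → P u v ⊎ P v u) →
    (∀ {u v} → P u v → ¬ P v u) → Orientation G
  fromRelation P? edge tot asym = record
    { out     = λ u v → does (P? u v)
    ; onEdge  = λ u v → edge ∘ does⁻ (P? u v)
    ; total   = λ u v uv → [ inj₁ ∘ dec-true (P? u v) , inj₂ ∘ dec-true (P? v u) ]′ (tot uv)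
    ; antisym = λ u v p q → asym (does⁻ (P? u v) p) (does⁻ (P? v u) q)
    }

  -- In a 1-perfect orientation agreeing with o on v w, the edge u v must point to v.
  Forced : Orientation G → Fin n → Fin n → Set
  Forced o u v = ∃ λ w → u ≢ w × out o v w ≡ true × adj G u w ≡ false

  forced? : ∀ o u v → Dec (Forced o u v)
  forced? o u v = any? λ w → ¬? (u Fin.≟ w) ×-dec (out o v w ≟ᵇ true) ×-dec (adj G u w ≟ᵇ false)

  forced⇒≢ : ∀ {o : Orientation G} {u v} → Forced o u v → u ≢ v
  forced⇒≢ {o} (w , _ , v→w , ¬uw) refl = not-¬ (onEdge o _ _ v→w) ¬uw

-- Clash-free orientations of co-bipartite graphs

module CoBipartiteGraph {n} {G : Graph n} (cobip : CoBipartite G) where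

  side : Fin n → Bool
  side = proj₁ cobip

  same-side⇒adj : ∀ {u v} → u ≢ v → side u ≡ side v → adj G u v ≡ true
  same-side⇒adj u≢v eq = ¬-not λ ¬uv → proj₂ cobip _ _ (u≢v , ¬uv) eq

  nonadj⇒opposite : ∀ {u v} → u ≢ v → adj G u v ≡ false → side v ≡ not (side u)
  nonadj⇒opposite u≢v ¬uv = ¬-not (proj₂ cobip _ _ (u≢v , ¬uv) ∘ sym)

  ClashFree : Orientation G → Set
  ClashFree o = ∀ {u v} → side u ≡ side v → Forced o u v → ¬ Forced o v u

  -- Whichever way the edge `u v` points, its tail gets two nonadjacent out-neighbours.
  onePerfect⇒clashFree : ∀ {o : Orientation G} → OnePerfect o → ClashFree o
  onePerfect⇒clashFree {o} perfect {u} {v} eq f@(w , u≢w , v→w , ¬uw) (x , v≢x , u→x , ¬vx)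
    with total o u v (same-side⇒adj (forced⇒≢ {o = o} f) eq)
  ... | inj₁ u→v = not-¬ (perfect u v x u→v u→x v≢x) ¬vx
  ... | inj₂ v→u = not-¬ (perfect v u w v→u v→w u≢w) ¬uw

  -- The witnesses `w` and `x` both lie on the side opposite to `u` and `v`, hence are adjacent, and
  -- `v w x u` is an induced 4-cycle. The tail of the edge `u v` has two out-neighbours on it.
  cyclic⇒clashFree : ∀ {o : Orientation G} →
    (∀ a b c d → Induced4Cycle G a b c d → CyclicallyOriented o a b c d) → ClashFree o
  cyclic⇒clashFree {o} cyclic {u} {v} eq f@(w , u≢w , v→w , ¬uw) (x , v≢x , u→x , ¬vx)
    with cyclic v w x u
      ( adj⇒≢ {G = G} vw , v≢x , u≢v ∘ sym , w≢x , u≢w ∘ sym , adj⇒≢ {G = G} ux ∘ sym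
      , vw , same-side⇒adj w≢x wx , adj-symʳ {G = G} ux , same-side⇒adj u≢v eq , ¬vx , adj-symʳ {G = G} ¬uw )
    where
    u≢v : u ≢ v
    u≢v = forced⇒≢ {o = o} f
    vw : adj G v w ≡ true
    vw = onEdge o v w v→w
    ux : adj G u x ≡ true
    ux = onEdge o u x u→x
    w≢x : w ≢ x
    w≢x refl = not-¬ vw ¬vx
    wx : side w ≡ side x
    wx = trans (nonadj⇒opposite u≢w ¬uw) (trans (cong not eq) (sym (nonadj⇒opposite v≢x ¬vx)))
  ... | at-v , _ , _ , at-u with total o u v (same-side⇒adj (forced⇒≢ {o = o} f) eq)
  ... | inj₁ u→v = two (trans (sym (outCount₄ o u)) at-u)
    where
    two : ind (out o u v) + (ind (out o u w) + (ind (out o u x) + (ind (out o u u) + 0))) ≢ 1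
    two rewrite u→v | u→x with out o u w
    ... | true  = λ ()
    ... | false = λ ()
  ... | inj₂ v→u = two (trans (sym (outCount₄ o v)) at-v)
    where
    two : ind (out o v v) + (ind (out o v w) + (ind (out o v x) + (ind (out o v u) + 0))) ≢ 1
    two rewrite v→u | v→w with out o v v | out o v x
    ... | true  | _     = λ ()
    ... | false | true  = λ ()
    ... | false | false = λ ()

  module _ (o : Orientation G) (clashFree : ClashFree o) where

    -- Crossing edges keep their direction in `o`. Edges within a side are reoriented as forced, or
    -- by index if neither direction is forced.
    Points : Fin n → Fin n → Set
    Points u v = adj G u v ≡ true ×
      (side u ≢ side v × out o u v ≡ true ⊎
       side u ≡ side v × (Forced o u v ⊎ ¬ Forced o v u × u Fin.< v))

    points? : ∀ u v → Dec (Points u v)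
    points? u v = (adj G u v ≟ᵇ true) ×-dec
      ((¬? (side u ≟ᵇ side v) ×-dec (out o u v ≟ᵇ true)) ⊎-dec
       ((side u ≟ᵇ side v) ×-dec (forced? o u v ⊎-dec (¬? (forced? o v u) ×-dec (u Fin.<? v)))))

    points-total : ∀ {u v} → adj G u v ≡ true → Points u v ⊎ Points v u
    points-total {u} {v} uv with side u ≟ᵇ side v
    ... | no neq = map⊎ (λ u→v → uv , inj₁ (neq , u→v))
                        (λ v→u → adj-symʳ {G = G} uv , inj₁ (neq ∘ sym , v→u)) (total o u v uv)
    ... | yes eq with forced? o u v | forced? o v u
    ... | yes f | _     = inj₁ (uv , inj₂ (eq , inj₁ f))
    ... | no _  | yes g = inj₂ (adj-symʳ {G = G} uv , inj₂ (sym eq , inj₁ g))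
    ... | no ¬f | no ¬g with Fin.<-cmp u v
    ... | tri< u<v _ _ = inj₁ (uv , inj₂ (eq , inj₂ (¬g , u<v)))
    ... | tri≈ _ u≡v _ = contradiction u≡v (adj⇒≢ {G = G} uv)
    ... | tri> _ _ v<u = inj₂ (adj-symʳ {G = G} uv , inj₂ (sym eq , inj₂ (¬f , v<u)))

    points-asym : ∀ {u v} → Points u v → ¬ Points v u
    points-asym (_ , inj₁ (_ , u→v)) (_ , inj₁ (_ , v→u)) = antisym o _ _ u→v v→u
    points-asym (_ , inj₁ (neq , _)) (_ , inj₂ (eq , _)) = neq (sym eq)
    points-asym (_ , inj₂ (eq , _)) (_ , inj₁ (neq , _)) = neq (sym eq)
    points-asym (_ , inj₂ (eq , inj₁ f)) (_ , inj₂ (_ , inj₁ g)) = clashFree eq f g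
    points-asym (_ , inj₂ (_ , inj₁ f)) (_ , inj₂ (_ , inj₂ (¬f , _))) = ¬f f
    points-asym (_ , inj₂ (_ , inj₂ (¬g , _))) (_ , inj₂ (_ , inj₁ g)) = ¬g g
    points-asym (_ , inj₂ (_ , inj₂ (_ , u<v))) (_ , inj₂ (_ , inj₂ (_ , v<u))) = Fin.<-asym u<v v<u

    -- If `u` and `w` were nonadjacent, `w` would witness that the edge `u v` is forced towards `v`.
    crossing-clique : ∀ {v u w} → side v ≡ side u → Forced o v u ⊎ ¬ Forced o u v × v Fin.< u →
      out o v w ≡ true → u ≢ w → adj G u w ≡ true
    crossing-clique eq p v→w u≢w = ¬-not λ ¬uw →
      let f = _ , u≢w , v→w , ¬uw in [ (λ g → clashFree eq g f) , (λ q → proj₁ q f) ]′ p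

    points-clique : ∀ {v u w} → Points v u → Points v w → u ≢ w → adj G u w ≡ true
    points-clique (_ , inj₂ (vu , _)) (_ , inj₂ (vw , _)) u≢w = same-side⇒adj u≢w (trans (sym vu) vw)
    points-clique (_ , inj₁ (vu , _)) (_ , inj₁ (vw , _)) u≢w =
      same-side⇒adj u≢w (not-injective (trans (sym (¬-not vu)) (¬-not vw)))
    points-clique (_ , inj₁ (_ , v→u)) (_ , inj₂ (eq , q)) u≢w =
      adj-symʳ {G = G} (crossing-clique eq q v→u (u≢w ∘ sym))
    points-clique (_ , inj₂ (eq , p)) (_ , inj₁ (_ , v→w)) u≢w = crossing-clique eq p v→w u≢w

    clashFree⇒onePerfect : OnePerfectlyOrientable G
    clashFree⇒onePerfect = fromRelation points? proj₁ points-total points-asym ,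
      λ v u w p q → points-clique (does⁻ (points? v u) p) (does⁻ (points? v w) q)

  C4⇒onePerfect : C4CyclicallyOrientable G → OnePerfectlyOrientable G
  C4⇒onePerfect (o , cyclic) = clashFree⇒onePerfect o (cyclic⇒clashFree {o} cyclic)

-- Intersecting arcs and their ends

_∈Arc?_ : ∀ x A → Dec (x ∈Arc A)
x ∈Arc? whole = (0ℚ ℚ.≤? x) ×-dec (x ℚ.<? 1ℚ)
x ∈Arc? seg s e _ _ = ((0ℚ ℚ.≤? x) ×-dec (x ℚ.<? 1ℚ)) ×-dec
  (((s ℚ.≤? e) ×-dec (s ℚ.≤? x) ×-dec (x ℚ.≤? e)) ⊎-dec
   ((e ℚ.<? s) ×-dec ((s ℚ.≤? x) ⊎-dec (x ℚ.≤? e))))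

0-onCircle : OnCircle 0ℚ
0-onCircle = ℚ.≤-refl , *<* (ℤ.+<+ (ℕ.s≤s ℕ.z≤n))

end : Arc → ℚ
end whole         = 0ℚ
end (seg _ e _ _) = e

end-onCircle : ∀ A → OnCircle (end A)
end-onCircle whole          = 0-onCircle
end-onCircle (seg _ _ _ oe) = oe

simple-meets-wrapped : ∀ {s e os oe s′ e′ os′ oe′ x} → s ℚ.≤ e → s ℚ.≤ x → x ℚ.≤ e →
  e′ ℚ.< s′ → s′ ℚ.≤ x ⊎ x ℚ.≤ e′ → e ∈Arc seg s′ e′ os′ oe′ ⊎ e′ ∈Arc seg s e os oe
simple-meets-wrapped {oe = oe} s≤e s≤x x≤e e′<s′ (inj₁ s′≤x) =
  inj₁ (oe , inj₂ (e′<s′ , inj₁ (ℚ.≤-trans s′≤x x≤e)))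
simple-meets-wrapped {e = e} {oe = oe} {e′ = e′} {oe′ = oe′} s≤e s≤x x≤e e′<s′ (inj₂ x≤e′)
  with ℚ.≤-total e e′
... | inj₁ e≤e′ = inj₁ (oe , inj₂ (e′<s′ , inj₂ e≤e′))
... | inj₂ e′≤e = inj₂ (oe′ , inj₁ (s≤e , ℚ.≤-trans s≤x x≤e′ , e′≤e))

-- Moving forward from a common point, the first end reached lies in both arcs.
meet⇒end∈ : ∀ A B {x} → x ∈Arc A → x ∈Arc B → end A ∈Arc B ⊎ end B ∈Arc A
meet⇒end∈ whole B _ _ = inj₂ (end-onCircle B)
meet⇒end∈ A@(seg _ _ _ _) whole _ _ = inj₁ (end-onCircle A)
meet⇒end∈ (seg _ e _ oe) (seg _ e′ _ oe′) (_ , inj₁ (s≤e , s≤x , x≤e)) (_ , inj₁ (s′≤e′ , s′≤x , x≤e′))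
  with ℚ.≤-total e e′
... | inj₁ e≤e′ = inj₁ (oe , inj₁ (s′≤e′ , ℚ.≤-trans s′≤x x≤e , e≤e′))
... | inj₂ e′≤e = inj₂ (oe′ , inj₁ (s≤e , ℚ.≤-trans s≤x x≤e′ , e′≤e))
meet⇒end∈ (seg _ _ os oe) (seg _ _ os′ oe′) (_ , inj₁ (s≤e , s≤x , x≤e)) (_ , inj₂ (e′<s′ , p)) =
  simple-meets-wrapped {os = os} {oe} {os′ = os′} {oe′} s≤e s≤x x≤e e′<s′ p
meet⇒end∈ (seg _ _ os oe) (seg _ _ os′ oe′) (_ , inj₂ (e<s , p)) (_ , inj₁ (s′≤e′ , s′≤x , x≤e′)) =
  swap (simple-meets-wrapped {os = os′} {oe′} {os′ = os} {oe} s′≤e′ s′≤x x≤e′ e<s p)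
-- Both arcs pass through 0, so the smaller end is the first one reached from there.
meet⇒end∈ (seg _ e _ oe) (seg _ e′ _ oe′) (_ , inj₂ (e<s , _)) (_ , inj₂ (e′<s′ , _))
  with ℚ.≤-total e e′
... | inj₁ e≤e′ = inj₁ (oe , inj₂ (e′<s′ , inj₂ e≤e′))
... | inj₂ e′≤e = inj₂ (oe′ , inj₂ (e<s , inj₂ e′≤e))

-- From an arc model to a 1-perfect orientation

module _ {n} {G : Graph n} (arcs : CircularArc G) where

  private
    A : Fin n → Arc
    A = proj₁ arcs

    -- When each arc contains the end of the other, the index breaks the tie.
    Points : Fin n → Fin n → Set
    Points u v = adj G u v ≡ true × end (A u) ∈Arc A v × (end (A v) ∈Arc A u → u Fin.< v)

    points? : ∀ u v → Dec (Points u v)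
    points? u v = (adj G u v ≟ᵇ true) ×-dec (end (A u) ∈Arc? A v) ×-dec
      ((end (A v) ∈Arc? A u) →-dec (u Fin.<? v))

    points-total : ∀ {u v} → adj G u v ≡ true → Points u v ⊎ Points v u
    points-total {u} {v} uv with Fin.<-cmp u v | end (A u) ∈Arc? A v | end (A v) ∈Arc? A u
    ... | tri≈ _ u≡v _ | _ | _ = contradiction u≡v (adj⇒≢ {G = G} uv)
    ... | tri< u<v _ _ | yes p | _ = inj₁ (uv , p , λ _ → u<v)
    ... | tri> _ _ v<u | _ | yes q = inj₂ (adj-symʳ {G = G} uv , q , λ _ → v<u)
    ... | _ | yes p | no ¬q = inj₁ (uv , p , λ q → contradiction q ¬q)
    ... | _ | no ¬p | yes q = inj₂ (adj-symʳ {G = G} uv , q , λ p → contradiction p ¬p)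
    ... | _ | no ¬p | no ¬q with Equivalence.to (proj₂ arcs u v (adj⇒≢ {G = G} uv)) uv
    ... | x , x∈u , x∈v = ⊥-elim ([ ¬p , ¬q ]′ (meet⇒end∈ (A u) (A v) x∈u x∈v))

    points-asym : ∀ {u v} → Points u v → ¬ Points v u
    points-asym (_ , p , u<v) (_ , q , v<u) = Fin.<-asym (u<v q) (v<u p)

  circularArc⇒onePerfect : OnePerfectlyOrientable G
  circularArc⇒onePerfect = fromRelation points? proj₁ points-total points-asym ,
    λ v u w p q u≢w → Equivalence.from (proj₂ arcs u w u≢w)
      (end (A v) , proj₁ (proj₂ (does⁻ (points? v u) p)) , proj₁ (proj₂ (does⁻ (points? v w) q)))

-- An increasing sequence of points on the circle

≤⇒≮ : ∀ {p q : ℚ} → p ℚ.≤ q → ¬ q ℚ.< p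
≤⇒≮ p≤q q<p = ℚ.<-irrefl refl (ℚ.≤-<-trans p≤q q<p)

-- mkℚ takes the denominator minus one, so pos k = k / (k + 1) lies on the circle.
pos : ℕ → ℚ
pos k = mkℚ (ℤ.+ k) k (coprime-sym (subst (λ m → Coprime m k) (ℕ.+-comm k 1) (coprime-+ (1-coprimeTo k))))

pos-mono : ∀ {k l} → k ℕ.≤ l → pos k ℚ.≤ pos l
pos-mono {k} {l} k≤l = *≤* (subst₂ ℤ._≤_ (ℤ.pos-* k (suc l)) (ℤ.pos-* l (suc k)) (ℤ.+≤+ (begin
  k ℕ.* suc l    ≡⟨ ℕ.*-suc k l ⟩
  k + k ℕ.* l    ≤⟨ ℕ.+-mono-≤ k≤l (ℕ.≤-reflexive (ℕ.*-comm k l)) ⟩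
  l + l ℕ.* k    ≡⟨ ℕ.*-suc l k ⟨
  l ℕ.* suc k    ∎)))
  where open ℕ.≤-Reasoning

pos-strict : ∀ {k l} → k ℕ.< l → pos k ℚ.< pos l
pos-strict {k} {l} k<l = *<* (subst₂ ℤ._<_ (ℤ.pos-* k (suc l)) (ℤ.pos-* l (suc k)) (ℤ.+<+ (begin-strict
  k ℕ.* suc l    ≡⟨ ℕ.*-suc k l ⟩
  k + k ℕ.* l    <⟨ ℕ.+-mono-<-≤ k<l (ℕ.≤-reflexive (ℕ.*-comm k l)) ⟩
  l + l ℕ.* k    ≡⟨ ℕ.*-suc l k ⟨
  l ℕ.* suc k    ∎)))
  where open ℕ.≤-Reasoning

pos-cancel-≤ : ∀ {k l} → pos k ℚ.≤ pos l → k ℕ.≤ l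
pos-cancel-≤ p = ℕ.≮⇒≥ λ l<k → ≤⇒≮ p (pos-strict l<k)

pos-onCircle : ∀ k → OnCircle (pos k)
pos-onCircle k = pos-mono ℕ.z≤n , *<* (subst₂ ℤ._<_ (ℤ.pos-* k 1) (ℤ.pos-* 1 (suc k)) (ℤ.+<+ (begin-strict
  k ℕ.* 1        ≡⟨ ℕ.*-identityʳ k ⟩
  k              <⟨ ℕ.n<1+n k ⟩
  suc k          ≡⟨ ℕ.*-identityˡ (suc k) ⟨
  1 ℕ.* suc k    ∎)))
  where open ℕ.≤-Reasoning

-- From a 1-perfect orientation to an arc model

module _ {n} {G : Graph n} (cobip : CoBipartite G) where
  open CoBipartiteGraph {G = G} cobip

  Crossing : Fin n → Fin n → Set
  Crossing u v = side u ≡ true × side v ≡ false × adj G u v ≡ true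

  crossing? : ∀ u v → Dec (Crossing u v)
  crossing? u v = (side u ≟ᵇ true) ×-dec (side v ≟ᵇ false) ×-dec (adj G u v ≟ᵇ true)

  -- If two conflicting edges had the same direction, their tails would lie on one side and each
  -- head would witness a forced direction of the edge between the tails, in both directions.
  clashFree⇒proper : ∀ {o : Orientation G} → ClashFree o → ProperColouring crossing? (out o)
  clashFree⇒proper {o} clashFree {x} {y} {x′} {y′} ((sx , sy , xy) , (sx′ , sy′ , x′y′) , ¬xy′ , ¬x′y) =
    ¬-not λ eq → clash eq (out o x y) refl
    where
    nonadj-xy′ : adj G x y′ ≡ false
    nonadj-xy′ = ¬-not λ xy′ → ¬xy′ (sx , sy′ , xy′)
    nonadj-x′y : adj G x′ y ≡ false
    nonadj-x′y = ¬-not λ x′y → ¬x′y (sx′ , sy , x′y)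
    side≢ : ∀ {u v} → side u ≡ true → side v ≡ false → u ≢ v
    side≢ su sv refl = not-¬ su sv
    clash : out o x y ≡ out o x′ y′ → ∀ b → out o x y ≡ b → ⊥
    clash eq true x→y = clashFree (trans sx (sym sx′))
      (y′ , side≢ sx sy′ , trans (sym eq) x→y , nonadj-xy′)
      (y , side≢ sx′ sy , x→y , nonadj-x′y)
    clash eq false ¬x→y = clashFree (trans sy (sym sy′))
      (x′ , side≢ sx′ sy ∘ sym , total-false o x′y′ (trans (sym eq) ¬x→y) , adj-symʳ {G = G} nonadj-x′y)
      (x , side≢ sx sy′ ∘ sym , total-false o xy ¬x→y , adj-symʳ {G = G} nonadj-xy′)

  -- Arcs of side true contain 0 and those of side false contain pos (n + 1). Of
  -- the two chains covering the crossing edges, the first describes the overlaps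
  -- before pos (n + 1) and the second those after it.
  module ArcModel {F : Bool → Fin n → Fin n → Set} (F? : ∀ t x y → Dec (F t x y))
    (chain : ∀ t → Chain (F t)) (cover : ∀ {x y} → Crossing x y ⇔ (F true x y ⊎ F false x y)) where

    -- The index is reflected about `suc n`, so on both halves a larger `k` lies closer to the
    -- middle.
    before after : ℕ → ℚ
    before k = pos k
    after k = pos (suc n + suc n ∸ k)

    before≤middle : ∀ {k} → k ℕ.≤ suc n → before k ℚ.≤ pos (suc n)
    before≤middle = pos-mono

    middle≤after : ∀ {k} → k ℕ.≤ suc n → pos (suc n) ℚ.≤ after k
    middle≤after {k} k≤ = pos-mono (subst (ℕ._≤ suc n + suc n ∸ k) (ℕ.m+n∸n≡m (suc n) (suc n))
      (ℕ.∸-monoʳ-≤ (suc n + suc n) k≤))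

    -- The bound on `k` keeps its truncated subtraction exact.
    after-cancel-≤ : ∀ {k l} → k ℕ.≤ suc n → after l ℚ.≤ after k → k ℕ.≤ l
    after-cancel-≤ k≤ = ℕ.∸-cancelʳ-≤ (ℕ.≤-trans k≤ (ℕ.m≤m+n _ _)) ∘ pos-cancel-≤

    rk th : Bool → Fin n → ℕ
    rk t = rank (F? t)
    -- The successor turns the strict `threshold < rank` into the weak inequality by which closed
    -- arcs meet.
    th t y = suc (threshold (F? t) y)

    rk≤n : ∀ t x → rk t x ℕ.≤ n
    rk≤n t x = card≤n (below? (F? t) x)

    rk≤ : ∀ t x → rk t x ℕ.≤ suc n
    rk≤ t x = ℕ.m≤n⇒m≤1+n (rk≤n t x)

    th≤ : ∀ t y → th t y ℕ.≤ suc n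
    th≤ t y = ℕ.s≤s (card≤n (outside? (F? t) y))

    arc : Bool → Fin n → Arc
    arc true  x = seg (after (rk false x)) (before (rk true x)) (pos-onCircle _) (pos-onCircle _)
    arc false y = seg (before (th true y)) (after (th false y)) (pos-onCircle _) (pos-onCircle _)

    -- Ranks are at most `n`, strictly below the middle index `suc n`; the strictness selects the
    -- wrapping case of `seg`.
    wraps : ∀ x → before (rk true x) ℚ.< after (rk false x)
    wraps x = ℚ.<-≤-trans (pos-strict (ℕ.s≤s (rk≤n true x))) (middle≤after (rk≤ false x))

    simple : ∀ y → before (th true y) ℚ.≤ after (th false y)
    simple y = ℚ.≤-trans (before≤middle (th≤ true y)) (middle≤after (th≤ false y))

    crossing⇒meet : ∀ {x y} → Crossing x y → ∃ λ p → p ∈Arc arc true x × p ∈Arc arc false y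
    crossing⇒meet {x} {y} xy with Equivalence.to cover xy
    -- The common point is the end of the arc of `x` here and its start in the other case.
    ... | inj₁ f = _ , (pos-onCircle _ , inj₂ (wraps x , inj₂ ℚ.≤-refl)) ,
      (pos-onCircle _ , inj₁ (simple y , pos-mono (threshold<rank (F? true) (chain true) f) ,
        ℚ.≤-trans (before≤middle (rk≤ true x)) (middle≤after (th≤ false y))))
    ... | inj₂ f = _ , (pos-onCircle _ , inj₂ (wraps x , inj₁ ℚ.≤-refl)) ,
      (pos-onCircle _ , inj₁ (simple y ,
        ℚ.≤-trans (before≤middle (th≤ true y)) (middle≤after (rk≤ false x)) ,
        pos-mono (ℕ.∸-monoʳ-≤ (suc n + suc n) (threshold<rank (F? false) (chain false) f))))

    meet⇒crossing : ∀ {x y p} → p ∈Arc arc true x → p ∈Arc arc false y → Crossing x y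
    meet⇒crossing {x} {y} (_ , inj₁ (s≤e , _)) _ = contradiction (wraps x) (≤⇒≮ s≤e)
    meet⇒crossing {x} {y} _ (_ , inj₂ (e<s , _)) = contradiction e<s (≤⇒≮ (simple y))
    meet⇒crossing {x} {y} (_ , inj₂ (_ , inj₁ s≤p)) (_ , inj₁ (_ , _ , p≤e)) =
      Equivalence.from cover (inj₂ (threshold<rank⁻¹ (F? false)
        (after-cancel-≤ (th≤ false y) (ℚ.≤-trans s≤p p≤e))))
    meet⇒crossing {x} {y} (_ , inj₂ (_ , inj₂ p≤e)) (_ , inj₁ (_ , s≤p , _)) =
      Equivalence.from cover (inj₁ (threshold<rank⁻¹ (F? true)
        (pos-cancel-≤ (ℚ.≤-trans s≤p p≤e))))

    0∈arc : ∀ x → pos 0 ∈Arc arc true x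
    0∈arc x = pos-onCircle 0 , inj₂ (wraps x , inj₂ (pos-mono ℕ.z≤n))

    middle∈arc : ∀ y → pos (suc n) ∈Arc arc false y
    middle∈arc y = pos-onCircle _ , inj₁ (simple y , before≤middle (th≤ true y) , middle≤after (th≤ false y))

    arcs-meet : ∀ u v → u ≢ v → adj G u v ≡ true ⇔
      (∃ λ p → p ∈Arc arc (side u) u × p ∈Arc arc (side v) v)
    arcs-meet u v u≢v with side u in su | side v in sv
    ... | true  | true  = mk⇔ (λ _ → _ , 0∈arc u , 0∈arc v)
                              (λ _ → same-side⇒adj u≢v (trans su (sym sv)))
    ... | false | false = mk⇔ (λ _ → _ , middle∈arc u , middle∈arc v)
                              (λ _ → same-side⇒adj u≢v (trans su (sym sv)))
    ... | true  | false = mk⇔ (λ uv → crossing⇒meet (su , sv , uv))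
                              (λ { (_ , p∈u , p∈v) → proj₂ (proj₂ (meet⇒crossing p∈u p∈v)) })
    ... | false | true  = mk⇔
      (λ uv → map₂ ×-swap (crossing⇒meet (sv , su , adj-symʳ {G = G} uv)))
      (λ { (_ , p∈u , p∈v) → adj-symʳ {G = G} (proj₂ (proj₂ (meet⇒crossing p∈v p∈u))) })

  onePerfect⇒circularArc : OnePerfectlyOrientable G → CircularArc G
  onePerfect⇒circularArc (o , perfect)
    with two-chain-cover crossing? (clashFree⇒proper {o} (onePerfect⇒clashFree {o} perfect))
  ... | F , F? , chain , cover = (λ v → arc (side v) v) , arcs-meet
    where open ArcModel F? chain cover

theorem10 : ∀ (n : ℕ) (G : Graph n) → CoBipartite G →
    (OnePerfectlyOrientable G ⇔ C4CyclicallyOrientable G) ×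
    (OnePerfectlyOrientable G ⇔ CircularArc G)
theorem10 n G cobip =
  mk⇔ (onePerfect⇒C4 {G = G}) (CoBipartiteGraph.C4⇒onePerfect {G = G} cobip) ,
  mk⇔ (onePerfect⇒circularArc {G = G} cobip) (circularArc⇒onePerfect {G = G})
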